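{- Let $\mu\in GF(q)\setminus\{0\}$ with $b:=\mu^2\neq1$, and let $(s,c)$ be either $\left(\frac{1+\mu}2,\left(\frac{1-\mu}2\right)^2\right)$ or $\left(\frac{1-\mu}2,\left(\frac{1+\mu}2\right)^2\right)$. Suppose that for some $P,Q\in\mathcal B_1$ with $P\neq Q$ the circles $\mathcal B^1_{(sP,c)}$ and $\mathcal B^1_{(sQ,c)}$ are tangential. Let $k$ be the multiplicative order of $Q\bar P$ in $GF(q^2)^\times$. Then $3\le k\le q+1$, and for every $R\in\mathcal B_1$ the circles $$\mathcal B^1_{(sR,c)},\ \mathcal B^1_{(sR(Q\bar P),c)},\ \mathcal B^1_{(sR(Q\bar P)^2,c)},\ \dots,\ \mathcal B^1_{(sR(Q\bar P)^{k-1},c)}$$ form a Steiner chain of length $k$ for $\mathcal B_1$ and $\mathcal B_b$. In particular, a Steiner chain of the same length $k$ can be constructed starting with any circle of $\{\mathcal B^1_{(sR,c)}:R\in\mathcal B_1\}$.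
   Context: Let $p$ be an odd prime, $m\ge1$, and $q=p^m$. $GF(q^2)$ denotes the quadratic extension of $GF(q)$, and for $z\in GF(q^2)$ we write $\bar z:=z^{q}$. The Miquelian Möbius plane $\mathbb M(q)$ has point set $GF(q^2)\cup\{\infty\}$; its circles of the first type are $\mathcal B^1_{(s,c)}=\{z\in GF(q^2):(z-s)(\bar z-\bar s)=c\}$ for $s\in GF(q^2)$, $c\in GF(q)\setminus\{0\}$ (circles of the second type are $\{z:\bar s z+s\bar z=c\}\cup\{\infty\}$ for $s\neq0$, $c\in GF(q)$). Two circles are called tangential if they have exactly one point in common. For $a\in GF(q)\setminus\{0\}$ put $\mathcal B_a:=\mathcal B^1_{(0,a)}$, and let $\tau(1,b)$ be the set of circles tangential to both $\mathcal B_1$ and $\mathcal B_b$. A Steiner chain of length $k\ge3$ for $\mathcal B_1$ and $\mathcal B_b$ is a sequence of $k$ pairwise distinct circles $T_1,\dots,T_k\in\tau(1,b)$ such that $T_i$ and $T_{i+1}$ are tangential for $i=1,\dots,k-1$ and $T_k$ and $T_1$ are tangential. -}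

module Defs where

open import Level using (Level; _⊔_; suc)
open import Algebra.Bundles using (CommutativeRing)
open import Algebra.Morphism.Structures using (module RingMorphisms)
import Algebra.Properties.Semiring.Exp as Exp
open import Data.Fin.Base using (Fin; toℕ)
open import Data.Maybe.Base using (Maybe; just; nothing)
open import Data.Maybe.Relation.Binary.Pointwise using (Pointwise)
open import Data.Nat.Base as ℕ using (ℕ)
open import Data.Product using (∃-syntax; ∃!; _×_)
open import Data.Empty.Polymorphic using (⊥)
open import Data.Sum.Base using (_⊎_)
open import Data.Unit.Polymorphic using (⊤)
open import Function.Bundles using (Inverse)
open import Relation.Binary.PropositionalEquality as ≡ using (_≡_; _≢_)
open import Relation.Nullary using (¬_)
open import Relation.Unary using (Pred; _≐_; _∩_)

-- The inverse is a total operation; its value at 0# is irrelevant.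
record Field (c ℓ : Level) : Set (suc (c ⊔ ℓ)) where
  field
    commutativeRing : CommutativeRing c ℓ

  open CommutativeRing commutativeRing public
  open Exp semiring using (_^_) public

  infix  8 _⁻¹
  infixl 7 _/_

  field
    _⁻¹        : Carrier → Carrier
    ⁻¹-cong    : ∀ {x y} → x ≈ y → x ⁻¹ ≈ y ⁻¹
    1≉0        : 1# ≉ 0#
    ⁻¹-inverse : ∀ x → x ≉ 0# → x * x ⁻¹ ≈ 1#

  _/_ : Carrier → Carrier → Carrier
  x / y = x * y ⁻¹

  2# : Carrier
  2# = 1# + 1#

  HasCardinality : ℕ → Set (c ⊔ ℓ)
  HasCardinality n = Inverse setoid (≡.setoid (Fin n))

  HasOrder : Carrier → ℕ → Set ℓ
  HasOrder x k =
    1 ℕ.≤ k × x ^ k ≈ 1# × (∀ j → 1 ℕ.≤ j → j ℕ.< k → x ^ j ≉ 1#)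

-- GF(q) ⊂ GF(q²).  The degree of K over F is 2 because of the cardinalities.
record QuadraticExtension (q : ℕ) (f ℓf k ℓk : Level) : Set (suc (f ⊔ ℓf ⊔ k ⊔ ℓk)) where
  field
    baseField     : Field f ℓf
    extField      : Field k ℓk
    base-card     : Field.HasCardinality baseField q
    ext-card      : Field.HasCardinality extField (q ℕ.^ 2)
    ι             : Field.Carrier baseField → Field.Carrier extField
    ι-isRingMonomorphism :
      RingMorphisms.IsRingMonomorphism
        (CommutativeRing.rawRing (Field.commutativeRing baseField))
        (CommutativeRing.rawRing (Field.commutativeRing extField)) ι

module MöbiusPlane {q : ℕ} {f ℓf k ℓk : Level} (E : QuadraticExtension q f ℓf k ℓk) where

  open QuadraticExtension E using (ι) public
  module F = Field (QuadraticExtension.baseField E)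
  module K = Field (QuadraticExtension.extField E)

  conj : K.Carrier → K.Carrier
  conj z = z K.^ q

  Point : Set k
  Point = Maybe K.Carrier

  pattern ∞     = nothing
  pattern fin z = just z

  _≈ₚ_ : Point → Point → Set (k ⊔ ℓk)
  _≈ₚ_ = Pointwise K._≈_

  PointSet : Set (k ⊔ suc ℓk)
  PointSet = Pred Point ℓk

  B¹ : K.Carrier → F.Carrier → PointSet
  B¹ s c (fin z) = (z K.- s) K.* (conj z K.- conj s) K.≈ ι c
  B¹ s c ∞       = ⊥

  B² : K.Carrier → F.Carrier → PointSet
  B² s c (fin z) = conj s K.* z K.+ s K.* conj z K.≈ ι c
  B² s c ∞       = ⊤

  -- Circles are compared as point sets: different parameters (s , c) of the
  -- second type may describe the same circle.
  IsCircle : PointSet → Set (f ⊔ ℓf ⊔ k ⊔ ℓk)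
  IsCircle C =
      (∃[ s ] ∃[ c ] (c F.≉ F.0# × C ≐ B¹ s c))
    ⊎ (∃[ s ] ∃[ c ] (s K.≉ K.0# × C ≐ B² s c))

  Tangential : PointSet → PointSet → Set (k ⊔ ℓk)
  Tangential C D = ∃! _≈ₚ_ (C ∩ D)

  B : F.Carrier → PointSet
  B a = B¹ K.0# a

  τ : F.Carrier → F.Carrier → Pred PointSet (f ⊔ ℓf ⊔ k ⊔ ℓk)
  τ a b C = IsCircle C × Tangential C (B a) × Tangential C (B b)

  -- The circles T₁ , … , Tₙ are indexed from 0 by Fin n.
  record IsSteinerChain (b : F.Carrier) (n : ℕ) (T : Fin n → PointSet)
                        : Set (f ⊔ ℓf ⊔ k ⊔ ℓk) where
    field
      length≥3    : 3 ℕ.≤ n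
      members     : ∀ i → τ F.1# b (T i)
      distinct    : ∀ i j → i ≢ j → ¬ (T i ≐ T j)
      consecutive : ∀ i j → toℕ j ≡ ℕ.suc (toℕ i) → Tangential (T i) (T j)
      closing     : ∀ i j → ℕ.suc (toℕ i) ≡ n → toℕ j ≡ 0 → Tangential (T i) (T j)

  StartsWith : {n : ℕ} → (Fin n → PointSet) → PointSet → Set (k ⊔ ℓk)
  StartsWith T C = ∃[ i ] (toℕ i ≡ 0 × T i ≐ C)

{-# OPTIONS --safe #-}

-- Put s = ν + d with s + d = 1, c = d² and b = ν².  For a norm-one R, the circle
-- with parameters (sR , c) meets 𝓑₁ only in R and 𝓑_b only in νR: a common point z
-- of it and the circle of radius a² has (z - aR)(z̄ - aR̄) = 0.  Multiplication by
-- a norm-one element preserves tangency, so the tangency at the pair (P , Q) is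
-- carried to every pair (R , RQP̄).  The touching points R(QP̄)ⁱ on 𝓑₁ tell the
-- circles apart, and (QP̄)^(q+1) = 1 bounds the length.  The length is not 2, since
-- for Q = -P the common points are closed under z ↦ -z, so that uniqueness forces
-- z = 0 and s² = c.  About z ↦ z^q only multiplicativity, oddness, and triviality
-- on GF(q) are needed; additivity is not.
module Submission where

open import Defs
open import Algebra.Morphism.Structures using (module RingMorphisms)
import Algebra.Properties.Ring as RingProperties
open import Data.Fin.Base using (Fin; zero; suc; toℕ; punchIn; fromℕ<)
open import Data.Fin.Permutation using (Permutation; permutation; _⟨$⟩ʳ_; remove; punchIn-permute)
open import Data.Fin.Properties as Fin using (punchInᵢ≢i; toℕ<n; toℕ-fromℕ<; toℕ-injective)
open import Data.Maybe.Relation.Binary.Pointwise using (just; drop-just)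
open import Data.Nat.Base as ℕ using (ℕ; zero; suc; s≤s; z≤n)
open import Data.Nat.Divisibility using (_∤_; divides; ∣-refl; ∣1⇒≡1; ∣m∣n⇒∣m+n)
open import Data.Nat.Primality using (Prime; euclidsLemma; prime[2]; prime⇒irreducible)
import Data.Nat.Properties as ℕₚ
open import Data.Product using (_×_; ∃-syntax; _,_; proj₁; proj₂)
open import Data.Sum.Base as Sum using (_⊎_; inj₁; inj₂)
open import Function.Bundles using (Inverse)
open import Level using (Level; _⊔_)
open import Relation.Binary.Core using (_Preserves_⟶_)
open import Relation.Binary.Definitions using (Decidable; tri<; tri≈; tri>)
open import Relation.Binary.PropositionalEquality as ≡ using (_≡_; _≢_)
open import Relation.Nullary using (¬_; yes; no; contradiction)
open import Relation.Nullary.Decidable using (map′)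
open import Relation.Unary using (_∈_; _≐_)
open import Relation.Unary.Properties using (≐-sym; ≐-trans)

-- Parity of odd prime powers.

2∤odd-prime^ : ∀ {p} m → Prime p → p ≢ 2 → 2 ∤ p ℕ.^ m
2∤odd-prime^ zero    _  _   2∣1 = contradiction (∣1⇒≡1 2∣1) λ ()
2∤odd-prime^ (suc m) pp p≢2 2∣p^m with euclidsLemma _ _ prime[2] 2∣p^m
... | inj₂ 2∣ = 2∤odd-prime^ m pp p≢2 2∣
... | inj₁ 2∣p with prime⇒irreducible pp 2∣p
...   | inj₁ ()
...   | inj₂ 2≡p = p≢2 (≡.sym 2≡p)

2∤2+n⇒2∤n : ∀ {n} → 2 ∤ 2 ℕ.+ n → 2 ∤ n
2∤2+n⇒2∤n 2∤2+n 2∣n = 2∤2+n (∣m∣n⇒∣m+n ∣-refl 2∣n)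

-- Field identities, signs and orders of elements.

module FieldProperties {a ℓ} (𝔽 : Field a ℓ) where
  open Field 𝔽
  open import Algebra.Properties.Ring ring
  open import Algebra.Properties.Semiring.Mult semiring using () renaming (_×_ to infixr 8 _·_)
  open import Algebra.Properties.Semiring.Exp semiring using (^-homo-*)
  open import Algebra.Solver.Ring.NaturalCoefficients.Default commutativeSemiring
  open import Relation.Binary.Reasoning.Setoid setoid

  *-cancelˡ : ∀ {x y z} → x ≉ 0# → x * y ≈ x * z → y ≈ z
  *-cancelˡ {x} {y} {z} x≉0 xy≈xz = begin
    y              ≈⟨ divide y ⟩
    x ⁻¹ * (x * y) ≈⟨ *-congˡ xy≈xz ⟩
    x ⁻¹ * (x * z) ≈⟨ divide z ⟨
    z              ∎
    where
    divide : ∀ w → w ≈ x ⁻¹ * (x * w)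
    divide w = begin
      w              ≈⟨ *-identityˡ w ⟨
      1# * w         ≈⟨ *-congʳ (⁻¹-inverse x x≉0) ⟨
      x * x ⁻¹ * w   ≈⟨ solve 3 (λ x y w → x :* y :* w := y :* (x :* w)) refl x (x ⁻¹) w ⟩
      x ⁻¹ * (x * w) ∎

  xy≈0∧x≉0⇒y≈0 : ∀ {x y} → x * y ≈ 0# → x ≉ 0# → y ≈ 0#
  xy≈0∧x≉0⇒y≈0 {x} xy≈0 x≉0 = *-cancelˡ x≉0 (trans xy≈0 (sym (zeroʳ x)))

  *-≉0 : ∀ {x y} → x ≉ 0# → y ≉ 0# → x * y ≉ 0#
  *-≉0 x≉0 y≉0 xy≈0 = y≉0 (xy≈0∧x≉0⇒y≈0 xy≈0 x≉0)

  xy≉0⇒x≉0 : ∀ {x y} → x * y ≉ 0# → x ≉ 0#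
  xy≉0⇒x≉0 {y = y} xy≉0 x≈0 = xy≉0 (trans (*-congʳ x≈0) (zeroˡ y))

  xy≉0⇒y≉0 : ∀ {x y} → x * y ≉ 0# → y ≉ 0#
  xy≉0⇒y≉0 {x} xy≉0 y≈0 = xy≉0 (trans (*-congˡ y≈0) (zeroʳ x))

  xy≈1⇒x≉0 : ∀ {x y} → x * y ≈ 1# → x ≉ 0#
  xy≈1⇒x≉0 xy≈1 = xy≉0⇒x≉0 λ xy≈0 → 1≉0 (trans (sym xy≈1) xy≈0)

  ^-≉0 : ∀ {x} n → x ≉ 0# → x ^ n ≉ 0#
  ^-≉0 zero    _   = 1≉0
  ^-≉0 (suc n) x≉0 = *-≉0 x≉0 (^-≉0 n x≉0)

  1^n≈1 : ∀ n → 1# ^ n ≈ 1#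
  1^n≈1 zero    = refl
  1^n≈1 (suc n) = trans (*-identityˡ _) (1^n≈1 n)

  -x*-y≈x*y : ∀ x y → - x * - y ≈ x * y
  -x*-y≈x*y x y = begin
    - x * - y     ≈⟨ -‿distribˡ-* x (- y) ⟨
    - (x * - y)   ≈⟨ -‿cong (-‿distribʳ-* x y) ⟨
    - - (x * y)   ≈⟨ -‿involutive (x * y) ⟩
    x * y         ∎

  -- Two signs cancel per pair of factors, and removing a pair keeps the exponent odd. This gives
  -- `conj (- x) ≈ - conj x` from oddness of `q` alone.
  odd-^-neg : ∀ {n} → 2 ∤ n → ∀ x → (- x) ^ n ≈ - (x ^ n)
  odd-^-neg {zero}        2∤0 x = contradiction (divides 0 ≡.refl) 2∤0
  odd-^-neg {suc zero}    _   x = sym (-‿distribˡ-* x 1#)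
  odd-^-neg {suc (suc n)} 2∤n x = begin
    - x * (- x * (- x) ^ n)   ≈⟨ *-congˡ (*-congˡ (odd-^-neg (2∤2+n⇒2∤n 2∤n) x)) ⟩
    - x * (- x * - (x ^ n))   ≈⟨ *-congˡ (-x*-y≈x*y x (x ^ n)) ⟩
    - x * (x * x ^ n)         ≈⟨ -‿distribˡ-* x (x * x ^ n) ⟨
    - (x * (x * x ^ n))       ∎

  -- In characteristic 2 the ones cancel in pairs and an odd sum leaves a single one. Against
  -- `card×1≈0` this rules out characteristic 2 for odd cardinality.
  odd-×1 : ∀ {n} → 2 ∤ n → 2# ≈ 0# → n · 1# ≈ 1#
  odd-×1 {zero}        2∤0 _   = contradiction (divides 0 ≡.refl) 2∤0
  odd-×1 {suc zero}    _   _   = +-identityʳ 1#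
  odd-×1 {suc (suc n)} 2∤n 2≈0 = begin
    1# + (1# + n · 1#)   ≈⟨ +-assoc 1# 1# (n · 1#) ⟨
    2# + n · 1#          ≈⟨ +-congʳ 2≈0 ⟩
    0# + n · 1#          ≈⟨ +-identityˡ (n · 1#) ⟩
    n · 1#               ≈⟨ odd-×1 (2∤2+n⇒2∤n 2∤n) 2≈0 ⟩
    1#                   ∎

  x≈-x⇒x≈0 : ∀ {x} → 2# ≉ 0# → x ≈ - x → x ≈ 0#
  x≈-x⇒x≈0 {x} 2≉0 x≈-x = xy≈0∧x≉0⇒y≈0 2x≈0 2≉0
    where
    2x≈0 : 2# * x ≈ 0#
    2x≈0 = begin
      2# * x          ≈⟨ distribʳ x 1# 1# ⟩
      1# * x + 1# * x ≈⟨ +-cong (*-identityˡ x) (*-identityˡ x) ⟩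
      x + x           ≈⟨ +-congˡ x≈-x ⟩
      x + - x         ≈⟨ -‿inverseʳ x ⟩
      0#              ∎

  x²≈1∧x≉1⇒x≈-1 : ∀ {x} → x * x ≈ 1# → x ≉ 1# → x ≈ - 1#
  x²≈1∧x≉1⇒x≈-1 {x} x²≈1 x≉1 = +-inverseˡ-unique x 1# (xy≈0∧x≉0⇒y≈0 product≈0 x-1≉0)
    where
    x-1≉0 : x - 1# ≉ 0#
    x-1≉0 x-1≈0 = x≉1 (x∙y⁻¹≈ε⇒x≈y x 1# x-1≈0)

    product≈0 : (x - 1#) * (x + 1#) ≈ 0#
    product≈0 = begin
      (x + - 1#) * (x + 1#)
        -- The semiring solver sees `- 1#` as an opaque `m`; the factor `1# + m` is collected here
        -- and cancelled afterwards.
        ≈⟨ solve 2 (λ x m → (x :+ m) :* (x :+ con 1) := (x :* x :+ m) :+ x :* (con 1 :+ m)) refl x (- 1#) ⟩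
      (x * x + - 1#) + x * (1# + - 1#)
        ≈⟨ +-congʳ (+-congʳ x²≈1) ⟩
      (1# + - 1#) + x * (1# + - 1#)
        ≈⟨ +-cong (-‿inverseʳ 1#) (*-congˡ (-‿inverseʳ 1#)) ⟩
      0# + x * 0#   ≈⟨ +-identityˡ _ ⟩
      x * 0#        ≈⟨ zeroʳ x ⟩
      0#            ∎

  order-minimal : ∀ {x n j} → HasOrder x n → 1 ℕ.≤ j → x ^ j ≈ 1# → n ℕ.≤ j
  order-minimal {j = j} (_ , _ , minimal) 1≤j x^j≈1 = ℕₚ.≮⇒≥ λ j<n → minimal j 1≤j j<n x^j≈1

  -- Cancelling `x ^ i` turns a coincidence into `x ^ (j ∸ i) ≈ 1#` with a positive exponent below
  -- the order.
  powers-distinct : ∀ {x n i j} → HasOrder x n → x ≉ 0# → i ℕ.< j → j ℕ.< n → x ^ i ≉ x ^ j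
  powers-distinct {x} {n} {i} {j} (_ , _ , minimal) x≉0 i<j j<n x^i≈x^j =
    minimal (j ℕ.∸ i) (ℕₚ.m<n⇒0<n∸m i<j) (ℕₚ.≤-<-trans (ℕₚ.m∸n≤m j i) j<n)
      (*-cancelˡ (^-≉0 i x≉0) (begin
        x ^ i * x ^ (j ℕ.∸ i)   ≈⟨ ^-homo-* x i (j ℕ.∸ i) ⟨
        x ^ (i ℕ.+ (j ℕ.∸ i))   ≡⟨ ≡.cong (x ^_) (ℕₚ.m+[n∸m]≡n (ℕₚ.<⇒≤ i<j)) ⟩
        x ^ j                   ≈⟨ x^i≈x^j ⟨
        x ^ i                   ≈⟨ *-identityʳ (x ^ i) ⟨
        x ^ i * 1#              ∎))

  -- Expanding at radius e and at radius s + e and comparing the two isolates x y.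
  two-radii⇒xy≈0 : ∀ {s e r r̄ x y} → s ≉ 0# → r * r̄ ≈ 1# →
                   (x + e * r) * (y + e * r̄) ≈ e * e →
                   (x + (s + e) * r) * (y + (s + e) * r̄) ≈ (s + e) * (s + e) →
                   x * y ≈ 0#
  two-radii⇒xy≈0 {s} {e} {r} {r̄} {x} {y} s≉0 rr̄≈1 at-e at-s+e = begin
    x * y           ≈⟨ +-identityʳ (x * y) ⟨
    x * y + 0#      ≈⟨ +-congˡ (trans (*-congˡ w≈0) (zeroʳ e)) ⟨
    x * y + e * w   ≈⟨ expand e at-e ⟩
    0#              ∎
    where
    w = x * r̄ + y * r

    -- Since `r * r̄ ≈ 1#`, the term `t * t * (r * r̄)` cancels the right-hand side, and what
    -- remains is linear in `t`.
    expand : ∀ t → (x + t * r) * (y + t * r̄) ≈ t * t → x * y + t * w ≈ 0#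
    expand t at-t = +-identityˡ-unique (x * y + t * w) (t * t) (begin
      x * y + t * w + t * t
        ≈⟨ +-congˡ (trans (*-congˡ rr̄≈1) (*-identityʳ (t * t))) ⟨
      x * y + t * w + t * t * (r * r̄)
        ≈⟨ solve 5 (λ t r r̄ x y → x :* y :+ t :* (x :* r̄ :+ y :* r) :+ t :* t :* (r :* r̄)
                               := (x :+ t :* r) :* (y :+ t :* r̄)) refl t r r̄ x y ⟩
      (x + t * r) * (y + t * r̄)   ≈⟨ at-t ⟩
      t * t                       ∎)

    w≈0 : w ≈ 0#
    w≈0 = xy≈0∧x≉0⇒y≈0 (+-identityˡ-unique (s * w) (x * y + e * w) (begin
      s * w + (x * y + e * w)
        ≈⟨ solve 4 (λ s e p w → s :* w :+ (p :+ e :* w) := p :+ (s :+ e) :* w) refl s e (x * y) w ⟩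
      x * y + (s + e) * w     ≈⟨ expand (s + e) at-s+e ⟩
      0#                      ≈⟨ expand e at-e ⟨
      x * y + e * w           ∎)) s≉0

-- Finite fields: characteristic and Fermat's theorem.

module FiniteField {a ℓ} (𝔽 : Field a ℓ) {n : ℕ} (card : Field.HasCardinality 𝔽 n) where
  open Field 𝔽
  open FieldProperties 𝔽
  open Inverse card using (to; from; to-cong; from-cong; strictlyInverseˡ; strictlyInverseʳ)
  open import Algebra.Properties.Ring ring
  open import Algebra.Properties.Semiring.Mult semiring using () renaming (_×_ to infixr 8 _·_)
  open import Relation.Binary.Reasoning.Setoid setoid
  import Algebra.Properties.CommutativeMonoid.Sum +-commutativeMonoid as Summation

  to-injective : ∀ {x y} → to x ≡ to y → x ≈ y
  to-injective {x} {y} eq = trans (sym (strictlyInverseʳ x)) (trans (from-cong eq) (strictlyInverseʳ y))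

  _≟_ : Decidable _≈_
  x ≟ y = map′ to-injective to-cong (to x Fin.≟ to y)

  xy≈0⇒x≈0∨y≈0 : ∀ {x y} → x * y ≈ 0# → x ≈ 0# ⊎ y ≈ 0#
  xy≈0⇒x≈0∨y≈0 {x} xy≈0 with x ≟ 0#
  ... | yes x≈0 = inj₁ x≈0
  ... | no  x≉0 = inj₂ (xy≈0∧x≉0⇒y≈0 xy≈0 x≉0)

  -- Finite sums and products are indexed by `Fin n`, so a bijection of the field is conjugated by
  -- the enumeration before invariance under permutation can be applied.
  permutationOf : (f g : Carrier → Carrier) → f Preserves _≈_ ⟶ _≈_ → g Preserves _≈_ ⟶ _≈_ →
                  (∀ x → f (g x) ≈ x) → (∀ x → g (f x) ≈ x) → Permutation n n
  permutationOf f g f-cong g-cong f∘g g∘f = permutation (λ i → to (f (from i))) (λ i → to (g (from i)))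
    (λ i → ≡.trans (to-cong (trans (f-cong (strictlyInverseʳ _)) (f∘g _))) (strictlyInverseˡ i))
    (λ i → ≡.trans (to-cong (trans (g-cong (strictlyInverseʳ _)) (g∘f _))) (strictlyInverseˡ i))

  -- The sum of all elements is invariant under translation by 1.
  card×1≈0 : n · 1# ≈ 0#
  card×1≈0 = +-identityʳ-unique (Summation.sum from) (n · 1#) (begin
    Summation.sum from + n · 1#                        ≈⟨ +-congˡ (Summation.sum-replicate n) ⟨
    Summation.sum from + Summation.sum {n} (λ _ → 1#)        ≈⟨ Summation.∑-distrib-+ from (λ _ → 1#) ⟨
    Summation.sum (λ i → from i + 1#)                  ≈⟨ Summation.sum-cong-≋ (λ i → strictlyInverseʳ (from i + 1#)) ⟨
    Summation.sum (λ i → from (translation ⟨$⟩ʳ i))    ≈⟨ Summation.sum-permute from translation ⟨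
    Summation.sum from                                 ∎)
    where
    translation : Permutation n n
    translation = permutationOf (_+ 1#) (_- 1#) +-congʳ +-congʳ
      (//-rightDividesˡ 1#) (//-rightDividesʳ 1#)

  odd⇒2≉0 : 2 ∤ n → 2# ≉ 0#
  odd⇒2≉0 2∤n 2≈0 = 1≉0 (trans (sym (odd-×1 2∤n 2≈0)) card×1≈0)

-- The product of all nonzero elements is invariant under multiplication by x ≉ 0.
fermat : ∀ {a ℓ} (𝔽 : Field a ℓ) {n} → Field.HasCardinality 𝔽 n →
         let open Field 𝔽 in ∀ x → x ^ n ≈ x
fermat 𝔽 {zero}  card x = contradiction (Inverse.to card x) λ ()
fermat 𝔽 {suc n} card x with FiniteField._≟_ 𝔽 card x (Field.0# 𝔽)
... | yes x≈0 = trans (*-congʳ x≈0) (trans (zeroˡ _) (sym x≈0))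
  where open Field 𝔽
... | no x≉0 = trans (*-congˡ x^n≈1) (*-identityʳ x)
  where
  open Field 𝔽 hiding (zero)
  open FieldProperties 𝔽
  open FiniteField 𝔽 card
  open Inverse card using (to; from; to-cong; strictlyInverseˡ; strictlyInverseʳ)
  open import Relation.Binary.Reasoning.Setoid setoid
  open import Algebra.Properties.CommutativeMonoid.Sum *-commutativeMonoid
    renaming (sum to product; sum-replicate to product-replicate; sum-permute to product-permute;
              sum-cong-≋ to product-cong; ∑-distrib-+ to product-*)

  product≉0 : ∀ {k} (v : Fin k → Carrier) → (∀ i → v i ≉ 0#) → product v ≉ 0#
  product≉0 {zero}  v v≉0 = 1≉0
  product≉0 {suc k} v v≉0 = *-≉0 (v≉0 zero) (product≉0 (λ i → v (suc i)) (λ i → v≉0 (suc i)))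

  x⁻¹x≈1 : x ⁻¹ * x ≈ 1#
  x⁻¹x≈1 = trans (*-comm (x ⁻¹) x) (⁻¹-inverse x x≉0)

  undo : ∀ {u v} → u * v ≈ 1# → ∀ y → u * (v * y) ≈ y
  undo uv≈1 y = trans (sym (*-assoc _ _ y)) (trans (*-congʳ uv≈1) (*-identityˡ y))

  scaling : Permutation (suc n) (suc n)
  scaling = permutationOf (x *_) (x ⁻¹ *_) *-congˡ *-congˡ (undo (⁻¹-inverse x x≉0)) (undo x⁻¹x≈1)

  index0 : Fin (suc n)
  index0 = to 0#

  scaling-fixes-0 : scaling ⟨$⟩ʳ index0 ≡ index0
  scaling-fixes-0 = to-cong (trans (*-congˡ (strictlyInverseʳ 0#)) (zeroʳ x))

  nonzero : Fin n → Carrier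
  nonzero j = from (punchIn index0 j)

  nonzero≉0 : ∀ j → nonzero j ≉ 0#
  nonzero≉0 j nz≈0 = punchInᵢ≢i index0 j
    (≡.trans (≡.sym (strictlyInverseˡ _)) (to-cong nz≈0))

  scaling⁺ : Permutation n n
  scaling⁺ = remove index0 scaling

  -- `remove` deletes `index0` from the domain and its image from the codomain. Scaling fixes 0, so
  -- both deletions hit the same index and `nonzero` enumerates both sides.
  nonzero-scaling⁺ : ∀ j → nonzero (scaling⁺ ⟨$⟩ʳ j) ≈ x * nonzero j
  nonzero-scaling⁺ j = begin
    from (punchIn index0 (scaling⁺ ⟨$⟩ʳ j))
      ≡⟨ ≡.cong (λ i → from (punchIn i (scaling⁺ ⟨$⟩ʳ j))) scaling-fixes-0 ⟨
    from (punchIn (scaling ⟨$⟩ʳ index0) (scaling⁺ ⟨$⟩ʳ j))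
      ≡⟨ ≡.cong from (punchIn-permute scaling index0 j) ⟨
    from (scaling ⟨$⟩ʳ punchIn index0 j)   ≈⟨ strictlyInverseʳ _ ⟩
    x * nonzero j                          ∎

  x^n≈1 : x ^ n ≈ 1#
  x^n≈1 = *-cancelˡ (product≉0 nonzero nonzero≉0) (begin
    product nonzero * x ^ n                       ≈⟨ *-comm _ _ ⟩
    x ^ n * product nonzero                       ≈⟨ *-congʳ (product-replicate n) ⟨
    product {n} (λ _ → x) * product nonzero       ≈⟨ product-* (λ _ → x) nonzero ⟨
    product (λ j → x * nonzero j)                 ≈⟨ product-cong nonzero-scaling⁺ ⟨
    product (λ j → nonzero (scaling⁺ ⟨$⟩ʳ j))     ≈⟨ product-permute nonzero scaling⁺ ⟨
    product nonzero                               ≈⟨ *-identityʳ _ ⟨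
    product nonzero * 1#                          ∎)

-- The circle parameters and their nondegeneracy.

-- d is the square root of c, so that {s , d} = {(1 + μ)/2 , (1 - μ)/2} and ν = ± μ.
record Parameters {a ℓ} (𝔽 : Field a ℓ) (b s c : Field.Carrier 𝔽) : Set (a ⊔ ℓ) where
  open Field 𝔽
  field
    {ν d}  : Carrier
    s≈ν+d  : s ≈ ν + d
    s+d≈1  : s + d ≈ 1#
    c≈d²   : c ≈ d * d
    b≈ν²   : b ≈ ν * ν
    ν≉0    : ν ≉ 0#
    b≉1    : b ≉ 1#

  open FieldProperties 𝔽
  open import Algebra.Properties.Ring ring
  open import Algebra.Solver.Ring.NaturalCoefficients.Default commutativeSemiring
  open import Relation.Binary.Reasoning.Setoid setoid

  -- From `s - d = ν` and `s + d = 1` follows `1 - b = (s + d)² - (s - d)² = 4sd`, so a vanishing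
  -- product would force `b = 1`.
  sd≉0 : s * d ≉ 0#
  sd≉0 sd≈0 = b≉1 (trans b≈ν² (sym (begin
    1#                              ≈⟨ *-identityˡ 1# ⟨
    1# * 1#                         ≈⟨ *-cong s+d≈1 s+d≈1 ⟨
    (s + d) * (s + d)               ≈⟨ *-cong (+-congʳ s≈ν+d) (+-congʳ s≈ν+d) ⟩
    (ν + d + d) * (ν + d + d)
      ≈⟨ solve 2 (λ ν d → (ν :+ d :+ d) :* (ν :+ d :+ d) := ν :* ν :+ con 4 :* ((ν :+ d) :* d)) refl ν d ⟩
    ν * ν + four * ((ν + d) * d)    ≈⟨ +-congˡ (*-congˡ (*-congʳ s≈ν+d)) ⟨
    ν * ν + four * (s * d)          ≈⟨ +-congˡ (trans (*-congˡ sd≈0) (zeroʳ four)) ⟩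
    ν * ν + 0#                      ≈⟨ +-identityʳ _ ⟩
    ν * ν                           ∎)))
    where
    -- Nested as the solver evaluates the literal `con 4`.
    four = 1# + 1# + 1# + 1#

  s≉0 : s ≉ 0#
  s≉0 = xy≉0⇒x≉0 sd≉0

  c≉0 : c ≉ 0#
  c≉0 c≈0 = *-≉0 d≉0 d≉0 (trans (sym c≈d²) c≈0)
    where
    d≉0 : d ≉ 0#
    d≉0 = xy≉0⇒y≉0 sd≉0

  -- Here `s² - c = (s - d)(s + d) = ν`. This later excludes the ratio -1 between neighbouring
  -- circles, and so chains of length 2.
  s²≉c : s * s ≉ c
  s²≉c s²≈c = ν≉0 (+-identityˡ-unique ν (d * d) (begin
    ν + d * d                       ≈⟨ +-congʳ (*-identityʳ ν) ⟨
    ν * 1# + d * d                  ≈⟨ +-congʳ (*-congˡ s+d≈1) ⟨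
    ν * (s + d) + d * d             ≈⟨ +-congʳ (*-congˡ (+-congʳ s≈ν+d)) ⟩
    ν * (ν + d + d) + d * d
      ≈⟨ solve 2 (λ ν d → ν :* (ν :+ d :+ d) :+ d :* d := (ν :+ d) :* (ν :+ d)) refl ν d ⟩
    (ν + d) * (ν + d)               ≈⟨ *-cong s≈ν+d s≈ν+d ⟨
    s * s                           ≈⟨ s²≈c ⟩
    c                               ≈⟨ c≈d² ⟩
    d * d                           ∎))

  ν≈s-d : ν ≈ s - d
  ν≈s-d = trans (sym (//-rightDividesʳ d ν)) (+-congʳ (sym s≈ν+d))

module _ {a ℓ} (𝔽 : Field a ℓ) (2≉0 : Field._≉_ 𝔽 (Field.2# 𝔽) (Field.0# 𝔽)) where
  open Field 𝔽
  open import Algebra.Solver.Ring.NaturalCoefficients.Default commutativeSemiring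
  open import Relation.Binary.Reasoning.Setoid setoid

  [1+x]/2+[1-x]/2≈1 : ∀ x → (1# + x) / 2# + (1# - x) / 2# ≈ 1#
  [1+x]/2+[1-x]/2≈1 x = begin
    (1# + x) * 2# ⁻¹ + (1# + - x) * 2# ⁻¹
      ≈⟨ solve 4 (λ o x y h → (o :+ x) :* h :+ (o :+ y) :* h := (o :+ o) :* h :+ (x :+ y) :* h) refl 1# x (- x) (2# ⁻¹) ⟩
    2# * 2# ⁻¹ + (x + - x) * 2# ⁻¹   ≈⟨ +-cong (⁻¹-inverse 2# 2≉0) (trans (*-congʳ (-‿inverseʳ x)) (zeroˡ _)) ⟩
    1# + 0#                          ≈⟨ +-identityʳ 1# ⟩
    1#                               ∎

  [1+x]/2≈x+[1-x]/2 : ∀ x → (1# + x) / 2# ≈ x + (1# - x) / 2#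
  [1+x]/2≈x+[1-x]/2 x = begin
    -- Inserting `x - x` in the numerator lets `1 + x` regroup as `2x + (1 - x)`, with `- x` an
    -- opaque variable for the solver.
    (1# + x) * 2# ⁻¹                              ≈⟨ *-congʳ (+-congˡ (+-identityʳ x)) ⟨
    (1# + (x + 0#)) * 2# ⁻¹                       ≈⟨ *-congʳ (+-congˡ (+-congˡ (-‿inverseʳ x))) ⟨
    (1# + (x + (x + - x))) * 2# ⁻¹
      ≈⟨ solve 4 (λ o x y h → (o :+ (x :+ (x :+ y))) :* h := (x :+ x) :* h :+ (o :+ y) :* h) refl 1# x (- x) (2# ⁻¹) ⟩
    (x + x) * 2# ⁻¹ + (1# - x) * 2# ⁻¹            ≈⟨ +-congʳ (*-congʳ (+-cong (*-identityʳ x) (*-identityʳ x))) ⟨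
    (x * 1# + x * 1#) * 2# ⁻¹ + (1# - x) * 2# ⁻¹  ≈⟨ +-congʳ (*-congʳ (distribˡ x 1# 1#)) ⟨
    x * 2# * 2# ⁻¹ + (1# - x) * 2# ⁻¹             ≈⟨ +-congʳ (*-assoc x 2# (2# ⁻¹)) ⟩
    x * (2# * 2# ⁻¹) + (1# - x) * 2# ⁻¹           ≈⟨ +-congʳ (*-congˡ (⁻¹-inverse 2# 2≉0)) ⟩
    x * 1# + (1# - x) * 2# ⁻¹                     ≈⟨ +-congʳ (*-identityʳ x) ⟩
    x + (1# - x) * 2# ⁻¹                          ∎

  halves : ∀ {ν b s c} → ν ≉ 0# → b ≈ ν * ν → b ≉ 1# →
           s ≈ (1# + ν) / 2# → c ≈ ((1# - ν) / 2#) ^ 2 → Parameters 𝔽 b s c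
  halves {ν} ν≉0 b≈ν² b≉1 s≈ c≈ = record
    { s≈ν+d = trans s≈ ([1+x]/2≈x+[1-x]/2 ν)
    ; s+d≈1 = trans (+-congʳ s≈) ([1+x]/2+[1-x]/2≈1 ν)
    ; c≈d²  = trans c≈ (*-congˡ (*-identityʳ _))
    ; b≈ν²  = b≈ν²
    ; ν≉0   = ν≉0
    ; b≉1   = b≉1
    }

-- Conjugation, norm-one elements and rotation of circles.

module Conjugation {q : ℕ} {f ℓf k ℓk : Level} (E : QuadraticExtension q f ℓf k ℓk) (2∤q : 2 ∤ q) where
  open MöbiusPlane E
  open QuadraticExtension E using (baseField; extField; base-card; ext-card; ι-isRingMonomorphism)
  open K
  open FieldProperties extField
  open FiniteField extField ext-card using (xy≈0⇒x≈0∨y≈0)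
  open RingMorphisms.IsRingMonomorphism ι-isRingMonomorphism public
    using (⟦⟧-cong; +-homo; *-homo; 1#-homo; 0#-homo; injective)
  open import Algebra.Properties.Ring ring
  open import Algebra.Properties.Semiring.Exp semiring using (^-congˡ)
  open import Algebra.Properties.CommutativeSemiring.Exp commutativeSemiring using (^-distrib-*)
  open import Algebra.Solver.Ring.NaturalCoefficients.Default commutativeSemiring
  open import Relation.Binary.Reasoning.Setoid setoid

  -- The base field has odd cardinality, so 2 is nonzero there, and the injective `ι` carries this
  -- to the extension.
  2≉0 : 2# ≉ 0#
  2≉0 2≈0 = FiniteField.odd⇒2≉0 baseField base-card 2∤q (injective (begin
    ι (F.1# F.+ F.1#)    ≈⟨ +-homo F.1# F.1# ⟩
    ι F.1# + ι F.1#      ≈⟨ +-cong 1#-homo 1#-homo ⟩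
    2#                   ≈⟨ 2≈0 ⟩
    0#                   ≈⟨ 0#-homo ⟨
    ι F.0#               ∎))

  ι-≉0 : ∀ {x} → x F.≉ F.0# → ι x ≉ 0#
  ι-≉0 x≉0 ιx≈0 = x≉0 (injective (trans ιx≈0 (sym 0#-homo)))

  ι-^ : ∀ x n → ι (x F.^ n) ≈ ι x ^ n
  ι-^ x zero    = 1#-homo
  ι-^ x (suc n) = trans (*-homo x (x F.^ n)) (*-congˡ (ι-^ x n))

  conj-cong : ∀ {x y} → x ≈ y → conj x ≈ conj y
  conj-cong = ^-congˡ q

  conj-* : ∀ x y → conj (x * y) ≈ conj x * conj y
  conj-* x y = ^-distrib-* x y q

  conj-neg : ∀ x → conj (- x) ≈ - conj x
  conj-neg = odd-^-neg 2∤q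

  -- `ι` commutes with powers, and `x ^ q ≈ x` in the base field by Fermat.
  conj-ι : ∀ x → conj (ι x) ≈ ι x
  conj-ι x = trans (sym (ι-^ x q)) (⟦⟧-cong (fermat baseField base-card x))

  conj-0 : conj 0# ≈ 0#
  conj-0 = trans (conj-cong (sym 0#-homo)) (trans (conj-ι F.0#) 0#-homo)

  conj-ι* : ∀ x y → conj (ι x * y) ≈ ι x * conj y
  conj-ι* x y = trans (conj-* (ι x) y) (*-congʳ (conj-ι x))

  Unitary : Carrier → Set ℓk
  Unitary u = u * conj u ≈ 1#

  unitary-conj : ∀ {u} → Unitary u → Unitary (conj u)
  unitary-conj {u} uū≈1 = trans (sym (conj-* u (conj u))) (trans (conj-cong uū≈1) (1^n≈1 q))

  unitary-* : ∀ {u v} → Unitary u → Unitary v → Unitary (u * v)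
  unitary-* {u} {v} uū≈1 vv̄≈1 = begin
    u * v * conj (u * v)        ≈⟨ *-congˡ (conj-* u v) ⟩
    u * v * (conj u * conj v)
      ≈⟨ solve 4 (λ a b c d → a :* b :* (c :* d) := a :* c :* (b :* d)) refl u v (conj u) (conj v) ⟩
    u * conj u * (v * conj v)   ≈⟨ *-cong uū≈1 vv̄≈1 ⟩
    1# * 1#                     ≈⟨ *-identityˡ 1# ⟩
    1#                          ∎

  unitary-^ : ∀ {u} → Unitary u → ∀ n → Unitary (u ^ n)
  unitary-^ uū≈1 zero    = trans (*-identityˡ _) (1^n≈1 q)
  unitary-^ uū≈1 (suc n) = unitary-* uū≈1 (unitary-^ uū≈1 n)

  x*u*ū≈x : ∀ {u} → Unitary u → ∀ x → x * u * conj u ≈ x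
  x*u*ū≈x uū≈1 x = trans (*-assoc x _ _) (trans (*-congˡ uū≈1) (*-identityʳ x))

  x*ū*u≈x : ∀ {u} → Unitary u → ∀ x → x * conj u * u ≈ x
  x*ū*u≈x uū≈1 x = trans (*-assoc x _ _) (trans (*-congˡ (trans (*-comm _ _) uū≈1)) (*-identityʳ x))

  B-norm : ∀ z → (z - 0#) * (conj z - conj 0#) ≈ z * conj z
  B-norm z = *-cong (minus0 refl) (minus0 conj-0)
    where
    minus0 : ∀ {x y} → y ≈ 0# → x - y ≈ x
    minus0 {x} y≈0 = trans (+-congˡ (trans (-‿cong y≈0) -0#≈0#)) (+-identityʳ x)

  ∈B1⇒unitary : ∀ {u} → fin u ∈ B F.1# → Unitary u
  ∈B1⇒unitary {u} u∈B = trans (sym (B-norm u)) (trans u∈B 1#-homo)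

  ∈B¹-cong : ∀ {S S′ z z′ c} → S ≈ S′ → z ≈ z′ → fin z ∈ B¹ S c → fin z′ ∈ B¹ S′ c
  ∈B¹-cong S≈S′ z≈z′ z∈ = trans
    (sym (*-cong (+-cong z≈z′ (-‿cong S≈S′)) (+-cong (conj-cong z≈z′) (-‿cong (conj-cong S≈S′))))) z∈

  B¹-cong : ∀ {S S′ c} → S ≈ S′ → B¹ S c ≐ B¹ S′ c
  B¹-cong {S} {S′} {c} S≈S′ = (λ {x} → to x) , (λ {x} → from x)
    where
    to : ∀ x → x ∈ B¹ S c → x ∈ B¹ S′ c
    to (fin z) = ∈B¹-cong S≈S′ refl

    from : ∀ x → x ∈ B¹ S′ c → x ∈ B¹ S c
    from (fin z) = ∈B¹-cong (sym S≈S′) refl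

  -- By multiplicativity of `conj` the factor `u * conj u`, which is 1, splits off from the equation
  -- of the circle.
  ∈B¹-rotate : ∀ {S z u c} → Unitary u → fin z ∈ B¹ S c → fin (z * u) ∈ B¹ (S * u) c
  ∈B¹-rotate {S} {z} {u} {c} uū≈1 z∈ = begin
    (z * u - S * u) * (conj (z * u) - conj (S * u))
      ≈⟨ *-congˡ (+-cong (conj-* z u) (-‿cong (conj-* S u))) ⟩
    (z * u - S * u) * (conj z * conj u - conj S * conj u)
      ≈⟨ *-cong ([y-z]x≈yx-zx u z S) ([y-z]x≈yx-zx (conj u) (conj z) (conj S)) ⟨
    (z - S) * u * ((conj z - conj S) * conj u)
      ≈⟨ solve 4 (λ a b c d → a :* b :* (c :* d) := a :* c :* (b :* d)) refl (z - S) u (conj z - conj S) (conj u) ⟩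
    (z - S) * (conj z - conj S) * (u * conj u)
      ≈⟨ *-cong z∈ uū≈1 ⟩
    ι c * 1#   ≈⟨ *-identityʳ (ι c) ⟩
    ι c        ∎

  -- The common point is rotated forward by `u`; any common point of the images is rotated back by
  -- the inverse `conj u`, where uniqueness is known. The new centres enter up to `≈`, so that each
  -- use can choose their form.
  tangential-rotate : ∀ {S S′ T T′ u c} → Unitary u → S * u ≈ T → S′ * u ≈ T′ →
                      Tangential (B¹ S c) (B¹ S′ c) → Tangential (B¹ T c) (B¹ T′ c)
  tangential-rotate uū≈1 Su≈T S′u≈T′ (∞ , (() , _) , _)
  tangential-rotate {S} {S′} {T} {T′} {u} {c} uū≈1 Su≈T S′u≈T′ (fin z , (z∈S , z∈S′) , unique) =
    fin (z * u) ,
    (zu∈ {S} {T} Su≈T z∈S , zu∈ {S′} {T′} S′u≈T′ z∈S′) ,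
    λ {y} → unique′ y
    where
    zu∈ : ∀ {X Y} → X * u ≈ Y → fin z ∈ B¹ X c → fin (z * u) ∈ B¹ Y c
    zu∈ {X} {Y} Xu≈Y z∈X = ∈B¹-cong {X * u} {Y} {z * u} {z * u} {c} Xu≈Y refl
      (∈B¹-rotate {X} {z} {u} {c} uū≈1 z∈X)

    back : ∀ {X Y} → X * u ≈ Y → Y * conj u ≈ X
    back {X} Xu≈Y = trans (*-congʳ (sym Xu≈Y)) (x*u*ū≈x uū≈1 X)

    unique′ : ∀ y → y ∈ B¹ T c × y ∈ B¹ T′ c → fin (z * u) ≈ₚ y
    unique′ ∞       (() , _)
    unique′ (fin y) (y∈T , y∈T′) = just (trans (*-congʳ z≈yū) (x*ū*u≈x uū≈1 y))
      where
      yū∈ : ∀ {X Y} → X * u ≈ Y → fin y ∈ B¹ Y c → fin (y * conj u) ∈ B¹ X c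
      yū∈ {X} {Y} Xu≈Y y∈Y = ∈B¹-cong {Y * conj u} {X} {y * conj u} {y * conj u} {c} (back Xu≈Y) refl
        (∈B¹-rotate {Y} {y} {conj u} {c} (unitary-conj uū≈1) y∈Y)

      z≈yū : z ≈ y * conj u
      z≈yū = drop-just (unique {fin (y * conj u)} (yū∈ {S} {T} Su≈T y∈T , yū∈ {S′} {T′} S′u≈T′ y∈T′))

  ∈B¹-neg : ∀ {S S′ z c} → S′ ≈ - S → fin z ∈ B¹ S c → fin (- z) ∈ B¹ S′ c
  ∈B¹-neg {S} {S′} {z} {c} S′≈-S z∈ = ∈B¹-cong (sym S′≈-S) refl (begin
    (- z - - S) * (conj (- z) - conj (- S))   ≈⟨ *-congˡ (+-cong (conj-neg z) (-‿cong (conj-neg S))) ⟩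
    (- z - - S) * (- conj z - - conj S)       ≈⟨ *-cong (-‿+-comm z (- S)) (-‿+-comm (conj z) (- conj S)) ⟩
    - (z - S) * - (conj z - conj S)           ≈⟨ -x*-y≈x*y _ _ ⟩
    (z - S) * (conj z - conj S)               ≈⟨ z∈ ⟩
    ι c                                       ∎)

  -- Negation swaps the two circles, hence fixes their only common point. As 2 is invertible that
  -- point is 0, and the equation of the circle at 0 is the conclusion.
  opposite-circles-meet-at-0 : ∀ {S S′ c} → S′ ≈ - S → Tangential (B¹ S c) (B¹ S′ c) → S * conj S ≈ ι c
  opposite-circles-meet-at-0 S′≈-S (∞ , (() , _) , _)
  opposite-circles-meet-at-0 {S} {S′} {c} S′≈-S (fin z , (z∈S , z∈S′) , unique) = begin
    S * conj S                       ≈⟨ -x*-y≈x*y S (conj S) ⟨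
    - S * - conj S                   ≈⟨ *-cong (+-identityˡ _) (+-identityˡ _) ⟨
    (0# - S) * (0# - conj S)         ≈⟨ *-congˡ (+-congʳ conj-0) ⟨
    (0# - S) * (conj 0# - conj S)    ≈⟨ ∈B¹-cong {S} {S} {z} {0#} {c} refl (x≈-x⇒x≈0 2≉0 z≈-z) z∈S ⟩
    ι c                              ∎
    where
    S≈-S′ : S ≈ - S′
    S≈-S′ = trans (sym (-‿involutive S)) (-‿cong (sym S′≈-S))

    z≈-z : z ≈ - z
    z≈-z = drop-just (unique {fin (- z)}
      (∈B¹-neg {S′} {S} {z} {c} S≈-S′ z∈S′ , ∈B¹-neg {S} {S′} {z} {c} S′≈-S z∈S))

  -- Needed because the centres `ι s * R * t ^ i` and `ι s * (R * t ^ i)` give circles that agree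
  -- only as point sets.
  τ-resp-≐ : ∀ {b C D} → C ≐ D → τ F.1# b C → τ F.1# b D
  τ-resp-≐ {b} {C} {D} C≐D (circle , tangential₁ , tangentialᵇ) =
    Sum.map (λ (S , c , c≉0 , C≐) → S , c , c≉0 , ≐-trans (≐-sym C≐D) C≐)
            (λ (S , c , S≉0 , C≐) → S , c , S≉0 , ≐-trans (≐-sym C≐D) C≐) circle ,
    resp (B F.1#) tangential₁ , resp (B b) tangentialᵇ
    where
    resp : ∀ B′ → Tangential C B′ → Tangential D B′
    resp B′ (x , (x∈C , x∈B′) , unique) =
      x , (proj₁ C≐D x∈C , x∈B′) , λ {y} (y∈D , y∈B′) → unique {y} (proj₂ C≐D y∈D , y∈B′)

  -- Unique contact with a circle centred at 0.

  module Touching {s e a b c : F.Carrier} (s≉0 : s F.≉ F.0#) (a≉0 : a F.≉ F.0#) (a≈s+e : a F.≈ s F.+ e)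
                  (c≈e² : c F.≈ e F.* e) (b≈a² : b F.≈ a F.* a) {R : Carrier} (RR̄≈1 : Unitary R) where

    ιa≈ιs+ιe : ι a ≈ ι s + ι e
    ιa≈ιs+ιe = trans (⟦⟧-cong a≈s+e) (+-homo s e)

    ιc≈ιe² : ι c ≈ ι e * ι e
    ιc≈ιe² = trans (⟦⟧-cong c≈e²) (*-homo e e)

    ιb≈ιa² : ι b ≈ ι a * ι a
    ιb≈ιa² = trans (⟦⟧-cong b≈a²) (*-homo a a)

    scaled-norm : ∀ x → (ι x * R) * (ι x * conj R) ≈ ι x * ι x
    scaled-norm x = begin
      (ι x * R) * (ι x * conj R)
        ≈⟨ solve 3 (λ x r r̄ → (x :* r) :* (x :* r̄) := x :* x :* (r :* r̄)) refl (ι x) R (conj R) ⟩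
      ι x * ι x * (R * conj R)   ≈⟨ *-congˡ RR̄≈1 ⟩
      ι x * ι x * 1#             ≈⟨ *-identityʳ _ ⟩
      ι x * ι x                  ∎

    -- As `a = s + e`, passing from the centre `ι s * r` to the contact point `ι a * r` costs
    -- `ι e * r`. This brings the circle equation into the shape of `two-radii⇒xy≈0`.
    recentre : ∀ x r → x - ι s * r ≈ (x - ι a * r) + ι e * r
    recentre x r = +-cancelʳ (ι s * r) _ _ (begin
      x - ι s * r + ι s * r                   ≈⟨ //-rightDividesˡ (ι s * r) x ⟩
      x                                       ≈⟨ //-rightDividesˡ (ι a * r) x ⟨
      x - ι a * r + ι a * r                   ≈⟨ +-congˡ (*-congʳ ιa≈ιs+ιe) ⟩
      x - ι a * r + (ι s + ι e) * r
        ≈⟨ solve 4 (λ w s e r → w :+ (s :+ e) :* r := w :+ e :* r :+ s :* r) refl (x - ι a * r) (ι s) (ι e) r ⟩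
      x - ι a * r + ι e * r + ι s * r         ∎)

    point : Carrier
    point = ι a * R

    point∈B¹ : fin point ∈ B¹ (ι s * R) c
    point∈B¹ = begin
      (point - ι s * R) * (conj point - conj (ι s * R))
        ≈⟨ *-congˡ (+-cong (conj-ι* a R) (-‿cong (conj-ι* s R))) ⟩
      (ι a * R - ι s * R) * (ι a * conj R - ι s * conj R)
        ≈⟨ *-cong (residue R) (residue (conj R)) ⟩
      (ι e * R) * (ι e * conj R)   ≈⟨ scaled-norm e ⟩
      ι e * ι e                    ≈⟨ ιc≈ιe² ⟨
      ι c                          ∎
      where
      residue : ∀ r → ι a * r - ι s * r ≈ ι e * r
      residue r = trans (recentre (ι a * r) r) (trans (+-congʳ (-‿inverseʳ _)) (+-identityˡ _))

    point∈B : fin point ∈ B b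
    point∈B = begin
      (point - 0#) * (conj point - conj 0#)   ≈⟨ B-norm point ⟩
      point * conj point                      ≈⟨ *-congˡ (conj-ι* a R) ⟩
      (ι a * R) * (ι a * conj R)              ≈⟨ scaled-norm a ⟩
      ι a * ι a                               ≈⟨ ιb≈ιa² ⟨
      ι b                                     ∎

    -- Measured from the contact point, membership in the two circles gives the two equations of
    -- `two-radii⇒xy≈0`, at `e` and at `s + e = a`. So `z - aR` or `conj z - a conj R` vanishes.
    point-unique : ∀ {z} → fin z ∈ B¹ (ι s * R) c → fin z ∈ B b → point ≈ z
    point-unique {z} z∈B¹ z∈B = Sum.[ from-z , from-z̄ ]′ (xy≈0⇒x≈0∨y≈0 (two-radii⇒xy≈0 (ι-≉0 s≉0) RR̄≈1 at-e at-a))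
      where
      zz̄≈a² : z * conj z ≈ ι a * ι a
      zz̄≈a² = trans (sym (B-norm z)) (trans z∈B ιb≈ιa²)

      at-e : ((z - ι a * R) + ι e * R) * ((conj z - ι a * conj R) + ι e * conj R) ≈ ι e * ι e
      at-e = begin
        ((z - ι a * R) + ι e * R) * ((conj z - ι a * conj R) + ι e * conj R)
          ≈⟨ *-cong (recentre z R) (recentre (conj z) (conj R)) ⟨
        (z - ι s * R) * (conj z - ι s * conj R)     ≈⟨ *-congˡ (+-congˡ (-‿cong (conj-ι* s R))) ⟨
        (z - ι s * R) * (conj z - conj (ι s * R))   ≈⟨ z∈B¹ ⟩
        ι c                                         ≈⟨ ιc≈ιe² ⟩
        ι e * ι e                                   ∎

      restore : ∀ x r → (x - ι a * r) + (ι s + ι e) * r ≈ x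
      restore x r = trans (+-congˡ (*-congʳ (sym ιa≈ιs+ιe))) (//-rightDividesˡ (ι a * r) x)

      at-a : ((z - ι a * R) + (ι s + ι e) * R) * ((conj z - ι a * conj R) + (ι s + ι e) * conj R)
             ≈ (ι s + ι e) * (ι s + ι e)
      at-a = begin
        ((z - ι a * R) + (ι s + ι e) * R) * ((conj z - ι a * conj R) + (ι s + ι e) * conj R)
          ≈⟨ *-cong (restore z R) (restore (conj z) (conj R)) ⟩
        z * conj z                      ≈⟨ zz̄≈a² ⟩
        ι a * ι a                       ≈⟨ *-cong ιa≈ιs+ιe ιa≈ιs+ιe ⟩
        (ι s + ι e) * (ι s + ι e)       ∎

      from-z : z - ι a * R ≈ 0# → point ≈ z
      from-z z-aR≈0 = sym (x∙y⁻¹≈ε⇒x≈y z _ z-aR≈0)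

      z̄≉0 : conj z ≉ 0#
      z̄≉0 = xy≉0⇒y≉0 λ zz̄≈0 → *-≉0 (ι-≉0 a≉0) (ι-≉0 a≉0) (trans (sym zz̄≈a²) zz̄≈0)

      -- Rather than conjugating back, `z` and `point` are compared after multiplication by
      -- `conj z`: both products equal `a²`, and `conj z` is nonzero because `a` is.
      from-z̄ : conj z - ι a * conj R ≈ 0# → point ≈ z
      from-z̄ z̄-aR̄≈0 = *-cancelˡ z̄≉0 (begin
        conj z * (ι a * R)           ≈⟨ *-comm (conj z) (ι a * R) ⟩
        (ι a * R) * conj z           ≈⟨ *-congˡ (x∙y⁻¹≈ε⇒x≈y (conj z) _ z̄-aR̄≈0) ⟩
        (ι a * R) * (ι a * conj R)   ≈⟨ scaled-norm a ⟩
        ι a * ι a                    ≈⟨ zz̄≈a² ⟨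
        z * conj z                   ≈⟨ *-comm z (conj z) ⟩
        conj z * z                   ∎)

    tangential : Tangential (B¹ (ι s * R) c) (B b)
    tangential = fin point , (point∈B¹ , point∈B) , λ {y} → unique y
      where
      unique : ∀ y → y ∈ B¹ (ι s * R) c × y ∈ B b → fin point ≈ₚ y
      unique ∞       (() , _)
      unique (fin z) (z∈B¹ , z∈B) = just (point-unique z∈B¹ z∈B)

  -- Steiner chains generated by one tangent pair.

  module SteinerChains {b s c : F.Carrier} (parameters : Parameters baseField b s c) where
    open Parameters parameters

    module Touching₁ {R : Carrier} (RR̄≈1 : Unitary R) =
      Touching {b = F.1#} s≉0 F.1≉0 (F.sym s+d≈1) c≈d² (F.sym (F.*-identityˡ F.1#)) RR̄≈1

    -- The contact argument allows either square root of `c`: the root `d` gives `s + d = 1` and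
    -- hence contact with the unit circle, while `- d` gives `s - d = ν` and contact with the circle
    -- of `b = ν²`.
    module Touchingᵇ {R : Carrier} (RR̄≈1 : Unitary R) =
      Touching s≉0 ν≉0 ν≈s-d (F.trans c≈d² (F.sym (FieldProperties.-x*-y≈x*y baseField d d))) b≈ν² RR̄≈1

    circle∈τ : ∀ {R} → Unitary R → τ F.1# b (B¹ (ι s * R) c)
    circle∈τ {R} RR̄≈1 =
      inj₁ (ι s * R , c , c≉0 , (λ x∈ → x∈) , (λ x∈ → x∈)) ,
      Touching₁.tangential RR̄≈1 , Touchingᵇ.tangential RR̄≈1

    -- The contact point of the first circle with the unit circle also lies on the second circle, so
    -- it is that circle's contact point. These points are `ι F.1# * R` and `ι F.1# * S`.
    circles-injective : ∀ {R S} → Unitary R → Unitary S → B¹ (ι s * R) c ≐ B¹ (ι s * S) c → R ≈ S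
    circles-injective {R} {S} RR̄≈1 SS̄≈1 (R⊆S , _) =
      *-cancelˡ (ι-≉0 F.1≉0) (sym (Touching₁.point-unique SS̄≈1 (R⊆S (TR.point∈B¹)) TR.point∈B))
      where module TR = Touching₁ RR̄≈1

    module Chain {P Q : Carrier} (PP̄≈1 : Unitary P) (QQ̄≈1 : Unitary Q) (P≉Q : P ≉ Q)
                 (tangential : Tangential (B¹ (ι s * P) c) (B¹ (ι s * Q) c))
                 {n : ℕ} (order : HasOrder (Q * conj P) n) where

      t : Carrier
      t = Q * conj P

      t-unitary : Unitary t
      t-unitary = unitary-* QQ̄≈1 (unitary-conj PP̄≈1)

      t≉0 : t ≉ 0#
      t≉0 = xy≈1⇒x≉0 t-unitary

      t≉1 : t ≉ 1#
      t≉1 t≈1 = P≉Q (begin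
        P              ≈⟨ *-identityˡ P ⟨
        1# * P         ≈⟨ *-congʳ t≈1 ⟨
        Q * conj P * P ≈⟨ x*ū*u≈x PP̄≈1 Q ⟩
        Q              ∎)

      -- Otherwise the tangent circles at `P` and `Q` have opposite centres, so the norm of
      -- `ι s * P`, which is `s²`, equals `c`.
      t≉-1 : t ≉ - 1#
      t≉-1 t≈-1 = s²≉c (injective (begin
        ι (s F.* s)                        ≈⟨ *-homo s s ⟩
        ι s * ι s                          ≈⟨ *-identityʳ _ ⟨
        ι s * ι s * 1#                     ≈⟨ *-congˡ PP̄≈1 ⟨
        ι s * ι s * (P * conj P)
          ≈⟨ solve 3 (λ s p p̄ → s :* s :* (p :* p̄) := s :* p :* (s :* p̄)) refl (ι s) P (conj P) ⟩
        ι s * P * (ι s * conj P)           ≈⟨ *-congˡ (conj-ι* s P) ⟨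
        ι s * P * conj (ι s * P)           ≈⟨ opposite-circles-meet-at-0 sQ≈-sP tangential ⟩
        ι c                                ∎))
        where
        sQ≈-sP : ι s * Q ≈ - (ι s * P)
        sQ≈-sP = begin
          ι s * Q                ≈⟨ *-congˡ (x*ū*u≈x PP̄≈1 Q) ⟨
          ι s * (Q * conj P * P) ≈⟨ *-congˡ (*-congʳ t≈-1) ⟩
          ι s * (- 1# * P)       ≈⟨ *-congˡ (-1*x≈-x P) ⟩
          ι s * - P              ≈⟨ -‿distribʳ-* (ι s) P ⟨
          - (ι s * P)            ∎

      3≤n : 3 ℕ.≤ n
      3≤n = atLeast3 order
        where
        -- Order 1 forces `t = 1` and order 2 forces `t = -1`, both already excluded.
        atLeast3 : ∀ {n} → HasOrder t n → 3 ℕ.≤ n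
        atLeast3 {zero}              (() , _)
        atLeast3 {suc zero}          (_ , t¹≈1 , _) = contradiction (trans (sym (*-identityʳ t)) t¹≈1) t≉1
        atLeast3 {suc (suc zero)}    (_ , t²≈1 , _) =
          contradiction (x²≈1∧x≉1⇒x≈-1 (trans (*-congˡ (sym (*-identityʳ t))) t²≈1) t≉1) t≉-1
        atLeast3 {suc (suc (suc n))} _ = s≤s (s≤s (s≤s z≤n))

      n≤q+1 : n ℕ.≤ q ℕ.+ 1
      -- `t * conj t` unfolds to `t ^ suc q`, so `t-unitary` is itself the power relation at
      -- exponent `q + 1`.
      n≤q+1 = ℕₚ.≤-trans (order-minimal order (s≤s z≤n) t-unitary) (ℕₚ.≤-reflexive (ℕₚ.+-comm 1 q))

      module _ {R : Carrier} (RR̄≈1 : Unitary R) where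

        circle : ℕ → PointSet
        circle i = B¹ (ι s * R * t ^ i) c

        circle≐ : ∀ i → circle i ≐ B¹ (ι s * (R * t ^ i)) c
        circle≐ i = B¹-cong (*-assoc (ι s) R (t ^ i))

        Rtⁱ-unitary : ∀ i → Unitary (R * t ^ i)
        Rtⁱ-unitary i = unitary-* RR̄≈1 (unitary-^ t-unitary i)

        -- The rotation by `R * t ^ i * conj P` sends `P` to `R * t ^ i` and `Q` to `R * t ^ suc i`.
        -- Comparing powers of `t` instead of indices also covers the closing pair, where `j = 0`
        -- and `t ^ n ≈ 1#`.
        circle-tangential : ∀ i j → t ^ j ≈ t ^ suc i → Tangential (circle i) (circle j)
        circle-tangential i j t^j≈t^[1+i] =
          tangential-rotate (unitary-* (Rtⁱ-unitary i) (unitary-conj PP̄≈1)) P-image Q-image tangential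
          where
          P-image : ι s * P * (R * t ^ i * conj P) ≈ ι s * R * t ^ i
          P-image = begin
            ι s * P * (R * t ^ i * conj P)
              ≈⟨ solve 5 (λ s p p̄ r w → s :* p :* (r :* w :* p̄) := s :* r :* w :* p :* p̄) refl (ι s) P (conj P) R (t ^ i) ⟩
            ι s * R * t ^ i * P * conj P   ≈⟨ x*u*ū≈x PP̄≈1 _ ⟩
            ι s * R * t ^ i                ∎

          Q-image : ι s * Q * (R * t ^ i * conj P) ≈ ι s * R * t ^ j
          Q-image = begin
            ι s * Q * (R * t ^ i * conj P)
              ≈⟨ solve 5 (λ s x p̄ r w → s :* x :* (r :* w :* p̄) := s :* r :* (x :* p̄ :* w)) refl (ι s) Q (conj P) R (t ^ i) ⟩
            ι s * R * (Q * conj P * t ^ i)   ≈⟨ *-congˡ t^j≈t^[1+i] ⟨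
            ι s * R * t ^ j                  ∎

        -- Equal circles share their contact point on the unit circle, so `R * t ^ i ≈ R * t ^ j`,
        -- against the distinctness of powers below the order.
        circle-distinct : ∀ {i j} → i ℕ.< j → j ℕ.< n → ¬ (circle i ≐ circle j)
        circle-distinct {i} {j} i<j j<n i≐j = powers-distinct order t≉0 i<j j<n
          (*-cancelˡ (xy≈1⇒x≉0 RR̄≈1) (circles-injective (Rtⁱ-unitary i) (Rtⁱ-unitary j)
            (≐-trans (≐-sym (circle≐ i)) (≐-trans i≐j (circle≐ j)))))

        steinerChain : IsSteinerChain b n (λ i → circle (toℕ i))
        steinerChain = record
          { length≥3    = 3≤n
          ; members     = λ i → τ-resp-≐ (≐-sym (circle≐ (toℕ i))) (circle∈τ (Rtⁱ-unitary (toℕ i)))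
          ; distinct    = distinct
          ; consecutive = λ i j j≡1+i → circle-tangential (toℕ i) (toℕ j) (reflexive (≡.cong (t ^_) j≡1+i))
          ; closing     = λ i j 1+i≡n j≡0 → circle-tangential (toℕ i) (toℕ j) (begin
              t ^ toℕ j         ≡⟨ ≡.cong (t ^_) j≡0 ⟩
              1#                ≈⟨ proj₁ (proj₂ order) ⟨
              t ^ n             ≡⟨ ≡.cong (t ^_) 1+i≡n ⟨
              t ^ suc (toℕ i)   ∎)
          }
          where
          distinct : (i j : Fin n) → i ≢ j → ¬ (circle (toℕ i) ≐ circle (toℕ j))
          distinct i j i≢j with ℕₚ.<-cmp (toℕ i) (toℕ j)
          ... | tri< i<j _ _ = circle-distinct i<j (toℕ<n j)
          ... | tri≈ _ i≡j _ = contradiction (toℕ-injective i≡j) i≢j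
          ... | tri> _ _ j<i = λ i≐j → circle-distinct j<i (toℕ<n i) (≐-sym i≐j)

        startsWith : ∀ {C} → C ≐ B¹ (ι s * R) c → StartsWith {n} (λ i → circle (toℕ i)) C
        startsWith C≐ = first , toℕ-fromℕ< 0<n ,
          ≐-trans (B¹-cong (trans (*-congˡ (reflexive (≡.cong (t ^_) (toℕ-fromℕ< 0<n)))) (*-identityʳ _))) (≐-sym C≐)
          where
          -- `HasOrder` contains `1 ≤ n`, so index 0 exists; there `t ^ 0` is 1 and the circle is
          -- the one at `R`.
          0<n = proj₁ order
          first = fromℕ< 0<n

mainTheorem8 : ∀ {f ℓf k ℓk : Level} (p m : ℕ) → Prime p → p ≢ 2 → 1 ℕ.≤ m →
    (E : QuadraticExtension (p ℕ.^ m) f ℓf k ℓk) →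
    let open MöbiusPlane E in
    (μ : F.Carrier) → μ F.≉ F.0# → μ F.^ 2 F.≉ F.1# →
    (s c : F.Carrier) →
    ( (s F.≈ (F.1# F.+ μ) F./ F.2# × c F.≈ ((F.1# F.- μ) F./ F.2#) F.^ 2)
    ⊎ (s F.≈ (F.1# F.- μ) F./ F.2# × c F.≈ ((F.1# F.+ μ) F./ F.2#) F.^ 2) ) →
    (P Q : K.Carrier) → fin P ∈ B F.1# → fin Q ∈ B F.1# → P K.≉ Q →
    Tangential (B¹ (ι s K.* P) c) (B¹ (ι s K.* Q) c) →
    (n : ℕ) → K.HasOrder (Q K.* conj P) n →
    (3 ℕ.≤ n × n ℕ.≤ p ℕ.^ m ℕ.+ 1)
    × ((R : K.Carrier) → fin R ∈ B F.1# →
    IsSteinerChain (μ F.^ 2) n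
    (λ i → B¹ (ι s K.* R K.* (Q K.* conj P) K.^ toℕ i) c))
    × ((C : PointSet) → (∃[ R ] (fin R ∈ B F.1# × C ≐ B¹ (ι s K.* R) c)) →
    ∃[ T ] (IsSteinerChain (μ F.^ 2) n T × StartsWith T C))
mainTheorem8 p m pp p≢2 _ E μ μ≉0 μ²≉1 s c s,c P Q P∈ Q∈ P≉Q tangential n order =
  (3≤n , n≤q+1) ,
  (λ R R∈ → steinerChain (∈B1⇒unitary R∈)) ,
  (λ C (R , R∈ , C≐) → _ , steinerChain (∈B1⇒unitary R∈) , startsWith (∈B1⇒unitary R∈) C≐)
  where
  open MöbiusPlane E
  open QuadraticExtension E using (baseField; base-card)

  2∤q : 2 ∤ p ℕ.^ m
  2∤q = 2∤odd-prime^ m pp p≢2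

  open Conjugation E 2∤q
  module FR = RingProperties F.ring

  2≉0ꟳ : F.2# F.≉ F.0#
  2≉0ꟳ = FiniteField.odd⇒2≉0 baseField base-card 2∤q

  μ^2≈μ*μ : μ F.^ 2 F.≈ μ F.* μ
  μ^2≈μ*μ = F.*-congˡ (F.*-identityʳ μ)

  parameters : Parameters baseField (μ F.^ 2) s c
  parameters = Sum.[ (λ (s≈ , c≈) → halves baseField 2≉0ꟳ μ≉0 μ^2≈μ*μ μ²≉1 s≈ c≈)
                   -- The second choice of `(s , c)` is the first with `- μ` in place of `μ`; the
                   -- square `b` is the same.
                   , (λ (s≈ , c≈) → halves baseField 2≉0ꟳ -μ≉0 μ^2≈-μ*-μ μ²≉1 s≈ (F.trans c≈ (^2-cong 1+μ≈1--μ)))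
                   ]′ s,c
    where
    -μ≉0 : F.- μ F.≉ F.0#
    -μ≉0 -μ≈0 = μ≉0 (FR.-‿injective (F.trans -μ≈0 (F.sym FR.-0#≈0#)))

    μ^2≈-μ*-μ : μ F.^ 2 F.≈ (F.- μ) F.* (F.- μ)
    μ^2≈-μ*-μ = F.trans μ^2≈μ*μ (F.sym (FieldProperties.-x*-y≈x*y baseField μ μ))

    1+μ≈1--μ : F.1# F.+ μ F.≈ F.1# F.- (F.- μ)
    1+μ≈1--μ = F.+-congˡ (F.sym (FR.-‿involutive μ))

    ^2-cong : ∀ {x y} → x F.≈ y → (x F./ F.2#) F.^ 2 F.≈ (y F./ F.2#) F.^ 2
    ^2-cong x≈y = F.*-cong (F.*-congʳ x≈y) (F.*-congʳ (F.*-congʳ x≈y))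

  open SteinerChains parameters
  open Chain (∈B1⇒unitary P∈) (∈B1⇒unitary Q∈) P≉Q tangential order
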